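{- Let $k\ge 1$ be an integer and let $(P_{k,n})_{n\ge0}$ be the generalized $k$-Pell-Tribonacci sequence. For every integer $n\geq 0$, $$\sum_{i=0}^{n}P_{k,i}^2=\frac{a_1P_{k,n+3}^2+a_2P_{k,n+2}^2+a_3P_{k,n+1}^2}{ -3k(k+2)}-\frac{b_1P_{k,n+1}P_{k,n+2}+b_2P_{k,n+2}P_{k,n+3}+b_3P_{k,n+1}P_{k,n+3}+c_1}{3k(k+2)},$$ where $a_1=1$, $a_2=4k^2+4k+1$, $a_3=3k^2+6k+1$, $b_1=2k-2$, $b_2=-4k-2$, $b_3=-2$, and $c_1=-1$.
   Context: For an integer $k\geq 1$, the generalized $k$-Pell-Tribonacci sequence $(P_{k,n})_{n\ge 0}$ is defined by $P_{k,0}=0$, $P_{k,1}=1$, $P_{k,2}=2k$ and $P_{k,n}=2kP_{k,n-1}+kP_{k,n-2}+P_{k,n-3}$ for $n\geq 3$. -}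

module Defs where

open import Data.Nat.Base as ℕ using (ℕ; zero; suc)
open import Data.Nat.Coprimality as Coprime using (1-coprimeTo)
open import Data.Integer.Base using (ℤ; +_; -_; _+_; _-_; _*_; _^_; ∣_∣)
open import Data.Rational.Base as ℚ using (ℚ; mkℚ)

-- The generalized k-Pell-Tribonacci sequence, P k n = P_{k,n}.
P : ℕ → ℕ → ℤ
P k 0 = + 0
P k 1 = + 1
P k 2 = + 2 * + k
P k (suc (suc (suc n))) =
  + 2 * + k * P k (suc (suc n)) + + k * P k (suc n) + P k n

-- Both bounds are inclusive: ∑[ i ≤ n ] f i = f 0 + f 1 + … + f n.
sumTo : ℕ → (ℕ → ℤ) → ℤ
sumTo zero    f = f zero
sumTo (suc n) f = sumTo n f + f (suc n)

infixl 10 sumTo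
syntax sumTo n (λ i → e) = ∑[ i ≤ n ] e

a₁ a₂ a₃ b₁ b₂ b₃ c₁ : ℕ → ℤ
a₁ k = + 1
a₂ k = + 4 * (+ k) ^ 2 + + 4 * + k + + 1
a₃ k = + 3 * (+ k) ^ 2 + + 6 * + k + + 1
b₁ k = + 2 * + k - + 2
b₂ k = - (+ 4) * + k - + 2
b₃ k = - (+ 2)
c₁ k = - (+ 1)

-- The denominator 1 is stored as 0, its predecessor.
fromℤ : ℤ → ℚ
fromℤ i = mkℚ i 0 (Coprime.sym (1-coprimeTo ∣ i ∣))

3k[k+2]≢0 : ∀ k .{{_ : ℕ.NonZero k}} →
            ℚ.NonZero (fromℤ (+ 3 * + k * (+ k + + 2)))
3k[k+2]≢0 (suc _) = _

-3k[k+2]≢0 : ∀ k .{{_ : ℕ.NonZero k}} →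
             ℚ.NonZero (fromℤ (- (+ 3) * + k * (+ k + + 2)))
-3k[k+2]≢0 (suc _) = _

{-# OPTIONS --safe #-}

-- Multiplying by −3k(k + 2), the claim becomes N(P_{n+1}, P_{n+2}, P_{n+3}) = −3k(k + 2) ∑ P_i²
-- for the sum N of the two numerators.  By induction it suffices that
-- N(y, z, 2kz + ky + x) − N(x, y, z) = −3k(k + 2) x², which is clear once the square in N is
-- completed, because (2kz + ky + x) − (2k + 1) z − y = −(z − (k − 1) y − x).
module Submission where

open import Defs
open import Data.Nat.Base as ℕ using (ℕ; zero; suc)
import Data.Nat.Properties as ℕ
open import Data.Integer.Base using (ℤ; +_; -[1+_]; -_; _+_; _-_; _*_; _^_)
import Data.Integer.Properties as ℤ
open import Data.Integer.Solver using (module +-*-Solver)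
open import Data.Integer.Tactic.RingSolver using (solve-∀)
open import Data.Rational.Base as ℚ using (_÷_; 1/_)
import Data.Rational.Properties as ℚ
open import Data.Rational.Unnormalised.Base using (*≡*)
import Data.Rational.Unnormalised.Properties as ℚᵘ
open import Relation.Binary.PropositionalEquality
  using (_≡_; refl; sym; trans; cong; cong₂; module ≡-Reasoning)

open ≡-Reasoning

squarePart mixedPart : ℕ → ℤ → ℤ → ℤ → ℤ
squarePart k x y z = a₁ k * z ^ 2 + a₂ k * y ^ 2 + a₃ k * x ^ 2
mixedPart  k x y z = b₁ k * x * y + b₂ k * y * z + b₃ k * x * z + c₁ k

completedSquare : ℤ → ℤ → ℤ → ℤ → ℤ
completedSquare k x y z =
  (z - (+ 2 * k + + 1) * y - x) * (z - (+ 2 * k + + 1) * y - x)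
    + + 3 * k * (k + + 2) * (x * x) - + 2 * (k + + 2) * (x * y) - + 1

-- The square supplies every term in `z`, and `y ^ 2` because `a₂ k` is (2k + 1)². The leftovers are
-- a₃ - 1 = 3k(k + 2) on `x ^ 2` and b₁ - 2(2k + 1) = -2(k + 2) on xy.
parts≡completedSquare : ∀ k x y z →
  squarePart k x y z + mixedPart k x y z ≡ completedSquare (+ k) x y z
parts≡completedSquare k = solve 4 (λ k x y z →
    (con (+ 1) :* z :^ 2
      :+ (con (+ 4) :* k :^ 2 :+ con (+ 4) :* k :+ con (+ 1)) :* y :^ 2
      :+ (con (+ 3) :* k :^ 2 :+ con (+ 6) :* k :+ con (+ 1)) :* x :^ 2)
    :+ ((con (+ 2) :* k :- con (+ 2)) :* x :* y
      :+ (con (- + 4) :* k :- con (+ 2)) :* y :* z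
      :+ con (- + 2) :* x :* z :+ con (- + 1))
    :=
    (z :- (con (+ 2) :* k :+ con (+ 1)) :* y :- x)
      :* (z :- (con (+ 2) :* k :+ con (+ 1)) :* y :- x)
      :+ con (+ 3) :* k :* (k :+ con (+ 2)) :* (x :* x)
      :- con (+ 2) :* (k :+ con (+ 2)) :* (x :* y) :- con (+ 1)) refl (+ k)
  where open +-*-Solver

-- With u = z - (2k + 1)y - x, the new square is (u + (k + 2)y)². Its excess over u², added to 3k(k
-- + 2)y² - 2(k + 2)yz, collapses to -2(k + 2)xy, the old mixed term. Only the old 3k(k + 2)x² is
-- then missing.
completedSquare-shift : ∀ k x y z →
  completedSquare k y z (+ 2 * k * z + k * y + x)
    ≡ completedSquare k x y z + x * x * (- + 3 * k * (k + + 2))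
completedSquare-shift = expanded
  where
  -- `completedSquare` is unfolded by hand to expose the polynomial to the ring solver.
  expanded : ∀ (k x y z : ℤ) →
    let w = + 2 * k * z + k * y + x in
    (w - (+ 2 * k + + 1) * z - y) * (w - (+ 2 * k + + 1) * z - y)
      + + 3 * k * (k + + 2) * (y * y) - + 2 * (k + + 2) * (y * z) - + 1
    ≡ (z - (+ 2 * k + + 1) * y - x) * (z - (+ 2 * k + + 1) * y - x)
      + + 3 * k * (k + + 2) * (x * x) - + 2 * (k + + 2) * (x * y) - + 1
      + x * x * (- + 3 * k * (k + + 2))
  expanded = solve-∀

-- The base of the square is -(k + 1), and (k + 1)² + 3k(k + 2) - 4k(k + 2) = 1. This is what fixes
-- c₁ = -1.
completedSquare-initial : ∀ k →
  completedSquare k (+ 1) (+ 2 * k) (+ 2 * k * (+ 2 * k) + k * + 1 + + 0) ≡ + 0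
completedSquare-initial = expanded
  where
  expanded : ∀ (k : ℤ) →
    let z = + 2 * k * (+ 2 * k) + k * + 1 + + 0 in
    (z - (+ 2 * k + + 1) * (+ 2 * k) - + 1) * (z - (+ 2 * k + + 1) * (+ 2 * k) - + 1)
      + + 3 * k * (k + + 2) * (+ 1 * + 1) - + 2 * (k + + 2) * (+ 1 * (+ 2 * k)) - + 1
    ≡ + 0
  expanded = solve-∀

completedSquare-sum : ∀ k n →
  completedSquare (+ k) (P k (1 ℕ.+ n)) (P k (2 ℕ.+ n)) (P k (3 ℕ.+ n))
    ≡ (∑[ i ≤ n ] (P k i ^ 2)) * (- + 3 * + k * (+ k + + 2))
-- The sum is the single term `P k 0 ^ 2`, so the right side computes to `+ 0`.
completedSquare-sum k zero    = completedSquare-initial (+ k)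
completedSquare-sum k (suc n) = begin
  completedSquare (+ k) y z (P k (4 ℕ.+ n))
    ≡⟨ completedSquare-shift (+ k) x y z ⟩
  completedSquare (+ k) x y z + x * x * e
    -- `x ^ 2` unfolds to `x * (x * + 1)`, hence the inserted factor.
    ≡⟨ cong₂ (λ s t → s + x * t * e) (completedSquare-sum k n) (sym (ℤ.*-identityʳ x)) ⟩
  s * e + x ^ 2 * e
    ≡⟨ ℤ.*-distribʳ-+ e s (x ^ 2) ⟨
  (s + x ^ 2) * e ∎
  where
  x = P k (1 ℕ.+ n)
  y = P k (2 ℕ.+ n)
  z = P k (3 ℕ.+ n)
  s = ∑[ i ≤ n ] (P k i ^ 2)
  e = - + 3 * + k * (+ k + + 2)

-- Passing to unnormalised rationals avoids the gcd reduction: there the sum is (i · 1 + j · 1) / 1.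
fromℤ-+ : ∀ i j → fromℤ (i + j) ≡ fromℤ i ℚ.+ fromℤ j
fromℤ-+ i j = ℚ.toℚᵘ-injective (ℚᵘ.≃-trans
  (*≡* (cong (_* + 1) (sym (cong₂ _+_ (ℤ.*-identityʳ i) (ℤ.*-identityʳ j)))))
  (ℚᵘ.≃-sym (ℚ.toℚᵘ-homo-+ (fromℤ i) (fromℤ j))))

fromℤ-* : ∀ i j → fromℤ (i * j) ≡ fromℤ i ℚ.* fromℤ j
fromℤ-* i j = ℚ.toℚᵘ-injective (ℚᵘ.≃-sym (ℚ.toℚᵘ-homo-* (fromℤ i) (fromℤ j)))

fromℤ-neg : ∀ i → fromℤ (- i) ≡ ℚ.- fromℤ i
fromℤ-neg i = ℚ.toℚᵘ-injective (ℚᵘ.≃-sym (ℚ.toℚᵘ-homo‿- (fromℤ i)))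

-- Both operations compute once the sign of the numerator is known.
1/-neg : ∀ p .{{_ : ℚ.NonZero p}} .{{_ : ℚ.NonZero (ℚ.- p)}} →
  1/ (ℚ.- p) ≡ ℚ.- (1/ p)
1/-neg (ℚ.mkℚ (+ suc _) _ _) = refl
1/-neg (ℚ.mkℚ -[1+ _ ]  _ _) = refl

-- The two denominators of the formula are opposite, so dividing a + b by `p` turns the second
-- summand into -b/q. The equation on `p` is a hypothesis because the theorem's first denominator is
-- not literally a negation.
split-quotient : ∀ {s a b p q} .{{_ : ℚ.NonZero p}} .{{_ : ℚ.NonZero q}} →
  p ≡ ℚ.- q → a ℚ.+ b ≡ s ℚ.* p → s ≡ (a ÷ p) ℚ.- (b ÷ q)
split-quotient {s} {a} {b} {p} {q} refl a+b≡s*p = begin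
  s                               ≡⟨ ℚ.*-identityʳ s ⟨
  s ℚ.* ℚ.1ℚ                      ≡⟨ cong (s ℚ.*_) (ℚ.*-inverseʳ p) ⟨
  s ℚ.* (p ℚ.* 1/ p)              ≡⟨ ℚ.*-assoc s p (1/ p) ⟨
  (s ℚ.* p) ℚ.* 1/ p              ≡⟨ cong (ℚ._* 1/ p) a+b≡s*p ⟨
  (a ℚ.+ b) ℚ.* 1/ p              ≡⟨ ℚ.*-distribʳ-+ (1/ p) a b ⟩
  (a ÷ p) ℚ.+ b ℚ.* 1/ p          ≡⟨ cong (λ r → (a ÷ p) ℚ.+ b ℚ.* r) (1/-neg q) ⟩
  (a ÷ p) ℚ.+ b ℚ.* (ℚ.- (1/ q))  ≡⟨ cong ((a ÷ p) ℚ.+_) (ℚ.neg-distribʳ-* b (1/ q)) ⟨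
  (a ÷ p) ℚ.- (b ÷ q)             ∎

-3k[k+2]≡neg : ∀ k → - + 3 * k * (k + + 2) ≡ - (+ 3 * k * (k + + 2))
-3k[k+2]≡neg = solve-∀

proposition4 : (k : ℕ) .{{_ : ℕ.NonZero k}} (n : ℕ) →
    fromℤ (∑[ i ≤ n ] (P k i ^ 2))
      ≡ (fromℤ (a₁ k * P k (n ℕ.+ 3) ^ 2
              + a₂ k * P k (n ℕ.+ 2) ^ 2
              + a₃ k * P k (n ℕ.+ 1) ^ 2)
          ÷ fromℤ (- (+ 3) * + k * (+ k + + 2))) {{ -3k[k+2]≢0 k }}
        ℚ.-
        (fromℤ (b₁ k * P k (n ℕ.+ 1) * P k (n ℕ.+ 2)
              + b₂ k * P k (n ℕ.+ 2) * P k (n ℕ.+ 3)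
              + b₃ k * P k (n ℕ.+ 1) * P k (n ℕ.+ 3)
              + c₁ k)
          ÷ fromℤ (+ 3 * + k * (+ k + + 2))) {{ 3k[k+2]≢0 k }}
proposition4 k n
  -- The indices become successors, on which the recursion of `P` computes.
  rewrite ℕ.+-comm n 1 | ℕ.+-comm n 2 | ℕ.+-comm n 3 =
  split-quotient {{ -3k[k+2]≢0 k }} {{ 3k[k+2]≢0 k }}
    (trans (cong fromℤ (-3k[k+2]≡neg (+ k))) (fromℤ-neg d))
    (begin
      fromℤ a ℚ.+ fromℤ b                  ≡⟨ fromℤ-+ a b ⟨
      fromℤ (a + b)                        ≡⟨ cong fromℤ (parts≡completedSquare k x y z) ⟩
      fromℤ (completedSquare (+ k) x y z)  ≡⟨ cong fromℤ (completedSquare-sum k n) ⟩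
      fromℤ (s * e)                        ≡⟨ fromℤ-* s e ⟩
      fromℤ s ℚ.* fromℤ e                  ∎)
  where
  x = P k (1 ℕ.+ n)
  y = P k (2 ℕ.+ n)
  z = P k (3 ℕ.+ n)
  a = squarePart k x y z
  b = mixedPart k x y z
  s = ∑[ i ≤ n ] (P k i ^ 2)
  d = + 3 * + k * (+ k + + 2)
  e = - + 3 * + k * (+ k + + 2)
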